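{- Let $\mathcal{E}$ (expressions) and $\mathcal{C}$ (constants) be sets, $\mathrm{enc}:\mathcal{E}\to\mathcal{C}$, $\mathrm{emb}:\mathcal{C}\to\mathcal{E}$, and $\bullet:\mathcal{E}\times\mathcal{E}\to\mathcal{E}$ an associative binary operation; define $e\ast f:=e\bullet\mathrm{emb}(\mathrm{enc}(f))$ and $\ulcorner\!\ulcorner e\urcorner\!\urcorner:=\mathrm{emb}(\mathrm{enc}(e))$. Suppose there is $f_{\mathrm{diag}}\in\mathcal{E}$ with $f_{\mathrm{diag}}\ast e=\ulcorner\!\ulcorner e\ast e\urcorner\!\urcorner$ for every $e\in\mathcal{E}$. Then for every $d\in\mathcal{E}$ there exists $f\in\mathcal{E}$ with $d\ast f=f$.
   Context: This is the setting of an "embeddable self-reference system": a self-reference system with application $\mathrm{app}(e,c)=e\bullet\mathrm{emb}(c)$; an $f_{\mathrm{diag}}$ as in the hypothesis is called a diagonaliser, and the conclusion is called the fixed-point property for all expressions. -}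

module Defs where

open import Level using (Level)
open import Algebra.Core using (Op₂)

module SelfReference {a b : Level} {Expr : Set a} {Const : Set b}
  (enc : Expr → Const) (emb : Const → Expr) (_•_ : Op₂ Expr) where

  infixl 7 _∗_

  app : Expr → Const → Expr
  app e c = e • emb c

  _∗_ : Op₂ Expr
  e ∗ f = app e (enc f)

  ⌜⌜_⌝⌝ : Expr → Expr
  ⌜⌜ e ⌝⌝ = emb (enc e)

{-# OPTIONS --safe #-}
module Submission where

open import Level using (Level)
open import Algebra.Core using (Op₂)
open import Algebra.Definitions using (Associative)
open import Data.Product using (∃-syntax; _,_)
open import Relation.Binary.PropositionalEquality using (_≡_; sym; cong; module ≡-Reasoning)
open import Defs

-- Diagonal argument: by associativity, `g = d • fdiag` satisfies `g ∗ e ≡ d ∗ (e ∗ e)` for every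
-- `e`. Self-application, `e = g`, makes `g ∗ g` a fixed point of `d`.

theorem3 : {a b : Level} {Expr : Set a} {Const : Set b}
    (enc : Expr → Const) (emb : Const → Expr) (_•_ : Op₂ Expr) →
    Associative _≡_ _•_ →
    let open SelfReference enc emb _•_ in
    ∃[ fdiag ] (∀ e → fdiag ∗ e ≡ ⌜⌜ e ∗ e ⌝⌝) →
    ∀ d → ∃[ f ] d ∗ f ≡ f
theorem3 enc emb _•_ assoc (fdiag , diag) d = g ∗ g , (begin
    d ∗ (g ∗ g)         ≡⟨⟩
    d • ⌜⌜ g ∗ g ⌝⌝     ≡⟨ cong (d •_) (sym (diag g)) ⟩
    -- `fdiag ∗ g` unfolds to `fdiag • ⌜⌜ g ⌝⌝`, so regrouping to the left exposes `d • fdiag`,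
    -- which is `g` itself.
    d • (fdiag ∗ g)     ≡⟨ sym (assoc d fdiag ⌜⌜ g ⌝⌝) ⟩
    g ∗ g               ∎)
  where
  open SelfReference enc emb _•_
  open ≡-Reasoning
  g = d • fdiag
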